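{- Let $G$ be a finite non-bipartite graph with chromatic number $\chi(G)$. Then $\chi(G)\neq\chi_c(G)$ if and only if there exist non-negative integers $r,s$ with $\frac{2r+1}{2s+1}>\frac{\chi(G)}{3(\chi(G)-2)}$ such that $\chi(G^{\frac{2r+1}{2s+1}})=3$. Moreover, $$\chi_c(G)=\inf\Big\{\tfrac{2n+1}{n-t}\ :\ \chi\big(G^{\frac{2n+1}{3(2t+1)}}\big)=3,\ n>t>0\Big\}.$$ Also, if $r,s$ are non-negative integers with $\frac{2r+1}{2s+1}\leq \frac{\chi(G)}{3(\chi(G)-2)}$, then $\chi(G^{\frac{2r+1}{2s+1}})=3$.
   Context: All graphs are finite. For a positive integer $k$, $G^{k}$ has vertex set $V(G)$, with $u,v$ adjacent iff there is a walk of length $k$ between them in $G$. $S_t(G)$ is obtained from $G$ by replacing each edge by a path with exactly $t-1$ inner vertices, and for non-negative integers $a,b$, $G^{\frac{2a+1}{2b+1}}:=(S_{2b+1}(G))^{2a+1}$ (in particular $G^{\frac{2n+1}{3(2t+1)}}=(S_{3(2t+1)}(G))^{2n+1}$). For integers $n\ge 2d\ge 2$, the circular complete graph $K_{n/d}$ has vertices $v_0,\ldots,v_{n-1}$ with $v_i v_j$ an edge iff $d\le |i-j|\le n-d$. The circular chromatic number $\chi_c(G)$ is the minimum of $n/d$ such that $G$ admits a homomorphism to $K_{n/d}$. -}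

module Defs where

open import Data.Nat using (ℕ; zero; suc; _+_; _*_; _∸_; _≤_; _<_; ∣_-_∣)
open import Data.Fin using (Fin; toℕ; fromℕ<)
open import Data.Bool using (Bool; true)
open import Data.Sum using (_⊎_; inj₁; inj₂)
open import Data.Product using (Σ; ∃; _×_; _,_; proj₁)
open import Relation.Binary.PropositionalEquality using (_≡_; _≢_)
open import Relation.Nullary using (¬_)

-- General graphs (a vertex type with an adjacency relation).
-- Loops are allowed in general graphs (they can arise in powers G^k);
-- a graph with a loop has no proper colouring.

record Graph : Set₁ where
  field
    V : Set
    E : V → V → Set
open Graph public

record SimpleGraph : Set where
  field
    n     : ℕ
    adj   : Fin n → Fin n → Bool
    sym   : ∀ u v → adj u v ≡ adj v u
    irrfl : ∀ u → adj u u ≢ true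
open SimpleGraph public

toGraph : SimpleGraph → Graph
toGraph G = record { V = Fin (n G) ; E = λ u v → adj G u v ≡ true }

data Walk (H : Graph) : ℕ → V H → V H → Set where
  here : ∀ {x} → Walk H zero x x
  step : ∀ {k x y z} → E H x y → Walk H k y z → Walk H (suc k) x z

Pow : Graph → ℕ → Graph
Pow H k = record { V = V H ; E = Walk H k }

-- an (undirected) edge of G, represented once as an ordered pair u < v
Edge : SimpleGraph → Set
Edge G = Σ (Fin (n G)) λ u → Σ (Fin (n G)) λ v → (toℕ u < toℕ v) × (adj G u v ≡ true)

SubV : SimpleGraph → ℕ → Set
SubV G t = Fin (n G) ⊎ (Edge G × Fin (t ∸ 1))

-- i-th vertex (0 ≤ i ≤ t) of the path replacing the edge e = (u,v):
-- position 0 is u, position t is v, position i (0<i<t) is inner vertex i-1.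
pathVertex : (G : SimpleGraph) (t : ℕ) → Edge G → ℕ → SubV G t
pathVertex G t (u , v , p) zero = inj₁ u
pathVertex G t (u , v , p) (suc i) with Data.Nat._<?_ i (t ∸ 1)
... | Relation.Nullary.yes i<t-1 = inj₂ ((u , v , p) , fromℕ< i<t-1)
... | Relation.Nullary.no  _     = inj₁ v

Subdivide : SimpleGraph → ℕ → Graph
Subdivide G t = record
  { V = SubV G t
  ; E = λ x y → Σ (Edge G) λ e → Σ ℕ λ i → (i < t) ×
          (((x ≡ pathVertex G t e i) × (y ≡ pathVertex G t e (suc i)))
           ⊎ ((y ≡ pathVertex G t e i) × (x ≡ pathVertex G t e (suc i))))
  }

FracPow : SimpleGraph → ℕ → ℕ → Graph
FracPow G a b = Pow (Subdivide G (suc (2 * b))) (suc (2 * a))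

Colorable : Graph → ℕ → Set
Colorable H m = Σ (V H → Fin m) λ c → ∀ x y → E H x y → c x ≢ c y

ChromaticNumber : Graph → ℕ → Set
ChromaticNumber H m = Colorable H m × (∀ j → j < m → ¬ Colorable H j)

NonBipartite : SimpleGraph → Set
NonBipartite G = ¬ Colorable (toGraph G) 2

-- Circular colourings: homomorphisms to K_{p/q}  (p ≥ 2q ≥ 2)

CircColorable : SimpleGraph → ℕ → ℕ → Set
CircColorable G p q =
  Σ (Fin (n G) → Fin p) λ c → ∀ u v → adj G u v ≡ true →
    (q ≤ ∣ toℕ (c u) - toℕ (c v) ∣) × (∣ toℕ (c u) - toℕ (c v) ∣ ≤ p ∸ q)

IsCircChromatic : SimpleGraph → ℕ → ℕ → Set
IsCircChromatic G p q =
  (1 ≤ q) × (2 * q ≤ p) × CircColorable G p q ×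
  (∀ p' q' → 1 ≤ q' → 2 * q' ≤ p' → CircColorable G p' q' → p * q' ≤ p' * q)

-- The set { (2n+1)/(n-t) : χ(G^{(2n+1)/(3(2t+1))}) = 3, n > t > 0 }
-- and "p/q is its infimum" (greatest lower bound, fractions with positive
-- denominators compared by cross-multiplication).

InSet : SimpleGraph → ℕ → ℕ → Set
InSet G nn t = (0 < t) × (t < nn) ×
  ChromaticNumber (Pow (Subdivide G (3 * suc (2 * t))) (suc (2 * nn))) 3

LowerBound : SimpleGraph → ℕ → ℕ → Set
LowerBound G a b = ∀ nn t → InSet G nn t → a * (nn ∸ t) ≤ suc (2 * nn) * b

IsInf : SimpleGraph → ℕ → ℕ → Set
IsInf G p q = LowerBound G p q × (∀ a b → 1 ≤ b → LowerBound G a b → a * q ≤ p * b)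

{-# OPTIONS --safe #-}

-- Put N = 3(2r+1) = 2m+1, so m = 3r+1.  For s < m, the power G^((2r+1)/(2s+1)) is
-- 3-colourable exactly when G maps to K_{N/(m−s)}; everything else is arithmetic of fractions.
-- Write the odd cycle C_N as K_{N/m}: its edges are the differences m and m+1 modulo N, so the
-- ends of a walk of length 2i+1 differ by m−i, …, m+1+i.
--
-- Given G → K_{N/(m−s)}, the ends of each edge are joined by a walk of length 2s+1 in C_N,
-- so S_{2s+1}(G) → C_N; cutting Z/N into three arcs of length 2r+1 then colours the power.
--
-- Conversely, let c be a 3-colouring of the (2r+1)-st power of H.  Place x at (2r+1)c(x) + j(x),
-- where j(x) counts the k < r such that x has a walk of length 2k+1 to colour c(x)−1, plus the
-- k < r such that x has a walk of length 2k+2 to colour c(x)+1.  If c(y) = c(x)+1 on an edge xy,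
-- the first count is r for y and the second is 0 for x, while the remaining two differ by
-- at most one, so j(y) − j(x) ∈ {r, r+1} and H → C_N.  The counts need "x has such a walk" to be
-- decidable; this is only assumed under a double negation, since the uses are inequalities in ℕ.
module Submission where

open import Defs hiding (sym)
open import Axiom.UniquenessOfIdentityProofs using (module Decidable⇒UIP)
open import Data.Bool using (Bool; true; false)
import Data.Bool.Properties as Bool
open import Data.Empty using (⊥-elim)
open import Data.Fin using (Fin; toℕ; fromℕ<; inject≤) renaming (suc to sucF)
open import Data.Fin.Patterns using (0F; 1F; 2F)
open import Data.Fin.Properties using (toℕ<n; toℕ-fromℕ<; fromℕ<-cong; toℕ-injective; inject≤-injective)
open import Data.List.Base using (_∷_; [])
open import Data.Nat
open import Data.Nat.DivMod
open import Data.Nat.Divisibility using (divides-refl)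
open import Data.Nat.Properties
open import Data.Nat.Tactic.RingSolver using (solve; solve-∀)
open import Data.Product using (Σ; ∃₂; _×_; _,_; proj₁; proj₂)
open import Data.Sum using (_⊎_; inj₁; inj₂; [_,_])
open import Function using (_∘_)
open import Function.Bundles using (_⇔_; mk⇔)
open import Relation.Binary.Definitions using (Symmetric; tri<; tri≈; tri>)
open import Relation.Binary.PropositionalEquality hiding ([_])
open import Relation.Nullary using (¬_; Dec; yes; no; does; Irrelevant)
open import Relation.Nullary.Decidable using (¬¬-excluded-middle; dec-true; dec-false; decidable-stable)

-- Adjacency in circular complete graphs and monotonicity in p/q

-- Adjacency in K_{p/q}, oriented from the smaller vertex and free of subtraction, so that it can be
-- rescaled and combined with linear identities.
Arc : ℕ → ℕ → ℕ → ℕ → Set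
Arc p q a b = (a + q ≤ b) × (b + q ≤ a + p)

Apart : ℕ → ℕ → ℕ → ℕ → Set
Apart p q a b = (q ≤ ∣ a - b ∣) × (∣ a - b ∣ ≤ p ∸ q)

apart-sym : ∀ {p q} a b → Apart p q a b → Apart p q b a
apart-sym {p} {q} a b = subst (λ d → (q ≤ d) × (d ≤ p ∸ q)) (∣-∣-comm a b)

arc⇒apart : ∀ {p q a b} → Arc p q a b → Apart p q a b
arc⇒apart {p} {q} {a} {b} (lo , hi) rewrite m≤n⇒∣m-n∣≡n∸m (m+n≤o⇒m≤o a lo) =
    m+n≤o⇒m≤o∸n q (subst (_≤ b) (+-comm a q) lo)
  , m≤n+o⇒m∸n≤o b a (subst (b ≤_) (+-∸-assoc a q≤p) (m+n≤o⇒m≤o∸n b hi))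
  where
  q≤p : q ≤ p
  q≤p = +-cancelˡ-≤ a q p (≤-trans lo (m+n≤o⇒m≤o b hi))

apart⇒arc-≤ : ∀ {p q a b} → q ≤ p → a ≤ b → Apart p q a b → Arc p q a b
apart⇒arc-≤ {p} {q} {a} {b} q≤p a≤b (lo , hi) rewrite m≤n⇒∣m-n∣≡n∸m a≤b =
    subst (_≤ b) (+-comm q a) (m≤o∸n⇒m+n≤o q a≤b lo)
  , (begin
      b + q             ≡⟨ cong (_+ q) (m∸n+n≡m a≤b) ⟨
      b ∸ a + a + q     ≤⟨ +-monoˡ-≤ q (+-monoˡ-≤ a hi) ⟩
      p ∸ q + a + q     ≡⟨ cong (_+ q) (+-comm (p ∸ q) a) ⟩
      a + (p ∸ q) + q   ≡⟨ +-assoc a (p ∸ q) q ⟩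
      a + (p ∸ q + q)   ≡⟨ cong (a +_) (m∸n+n≡m q≤p) ⟩
      a + p             ∎)
  where open ≤-Reasoning

apart⇒arc : ∀ {p q} a b → q ≤ p → Apart p q a b → Arc p q a b ⊎ Arc p q b a
apart⇒arc a b q≤p ap with ≤-total a b
... | inj₁ a≤b = inj₁ (apart⇒arc-≤ q≤p a≤b ap)
... | inj₂ b≤a = inj₂ (apart⇒arc-≤ q≤p b≤a (apart-sym a b ap))

arcs⇒apart : ∀ {p q} a b → Arc p q a b ⊎ Arc p q b a → Apart p q a b
arcs⇒apart a b (inj₁ ab) = arc⇒apart ab
arcs⇒apart a b (inj₂ ba) = apart-sym b a (arc⇒apart ba)

[m+o*n]/n≡m/n+o : ∀ m o n .{{_ : NonZero n}} → (m + o * n) / n ≡ m / n + o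
[m+o*n]/n≡m/n+o m o n = trans (+-distrib-/-∣ʳ m (divides-refl o)) (cong (m / n +_) (m*n/n≡m o n))

-- Multiplying by p′/p stretches a gap of q to at least q′, and rounding down commutes with adding
-- the integer q′. The second bound is the first one applied to b and a + p.
scale-arc : ∀ {p q p′ q′ a b} .{{_ : NonZero p}} → p * q′ ≤ p′ * q →
            Arc p q a b → Arc p′ q′ (a * p′ / p) (b * p′ / p)
scale-arc {p} {q} {p′} {q′} {a} {b} le (lo , hi) =
    (begin
      a * p′ / p + q′          ≡⟨ [m+o*n]/n≡m/n+o (a * p′) q′ p ⟨
      (a * p′ + q′ * p) / p    ≤⟨ /-monoˡ-≤ p (shift a b lo) ⟩
      b * p′ / p               ∎)
  , (begin
      b * p′ / p + q′          ≡⟨ [m+o*n]/n≡m/n+o (b * p′) q′ p ⟨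
      (b * p′ + q′ * p) / p    ≤⟨ /-monoˡ-≤ p (shift b (a + p) hi) ⟩
      (a + p) * p′ / p         ≡⟨ cong (_/ p) (trans (*-distribʳ-+ p′ a p) (cong (a * p′ +_) (*-comm p p′))) ⟩
      (a * p′ + p′ * p) / p    ≡⟨ [m+o*n]/n≡m/n+o (a * p′) p′ p ⟩
      a * p′ / p + p′          ∎)
  where
  open ≤-Reasoning
  shift : ∀ x y → x + q ≤ y → x * p′ + q′ * p ≤ y * p′
  shift x y x+q≤y = begin
    x * p′ + q′ * p   ≡⟨ cong (x * p′ +_) (*-comm q′ p) ⟩
    x * p′ + p * q′   ≤⟨ +-monoʳ-≤ (x * p′) le ⟩
    x * p′ + p′ * q   ≡⟨ cong (x * p′ +_) (*-comm p′ q) ⟩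
    x * p′ + q * p′   ≡⟨ *-distribʳ-+ p′ x q ⟨
    (x + q) * p′      ≤⟨ *-monoˡ-≤ p′ x+q≤y ⟩
    y * p′            ∎

-- Composes the colouring with the standard homomorphism i ↦ ⌊i p′/p⌋ from K_{p/q} to K_{p′/q′}.
circ-mono : ∀ G {p q p′ q′} .{{_ : NonZero p}} .{{_ : NonZero p′}} → q ≤ p →
            p * q′ ≤ p′ * q → CircColorable G p q → CircColorable G p′ q′
circ-mono G {p} {q} {p′} {q′} q≤p le (c , ok) = c′ , ok′
  where
  bound : ∀ (i : Fin p) → toℕ i * p′ / p < p′
  bound i = m<n*o⇒m/o<n (subst (toℕ i * p′ <_) (*-comm p p′) (*-monoˡ-< p′ (toℕ<n i)))
  c′ : Fin (n G) → Fin p′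
  c′ u = fromℕ< (bound (c u))
  ok′ : ∀ u v → adj G u v ≡ true → Apart p′ q′ (toℕ (c′ u)) (toℕ (c′ v))
  ok′ u v uv rewrite toℕ-fromℕ< (bound (c u)) | toℕ-fromℕ< (bound (c v))
    with apart⇒arc (toℕ (c u)) (toℕ (c v)) q≤p (ok u v uv)
  ... | inj₁ a = arcs⇒apart (toℕ (c u) * p′ / p) (toℕ (c v) * p′ / p) (inj₁ (scale-arc le a))
  ... | inj₂ a = arcs⇒apart (toℕ (c u) * p′ / p) (toℕ (c v) * p′ / p) (inj₂ (scale-arc le a))

-- Displacement along walks in the odd cycle

-- 2(b − a) is a sum of len signs (e minuses, f pluses) plus N times an integer
-- l − k of the same parity as len.
record Near (N len a b : ℕ) : Set where
  constructor near
  field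
    e f k l y : ℕ
    signs   : e + f ≡ len
    winding : k + l ≡ len + 2 * y
    balance : 2 * b + e + N * k ≡ 2 * a + f + N * l

near-sym : ∀ {N len a b} → Near N len a b → Near N len b a
near-sym (near e f k l y s p eq) =
  near f e l k y (trans (+-comm f e) s) (trans (+-comm l k) p) (sym eq)

near-trans : ∀ {N s t a b c} → Near N s a b → Near N t b c → Near N (s + t) a c
near-trans {N} {s} {t} {a} {b} {c} (near e f k l y p₁ p₂ p₃) (near e′ f′ k′ l′ y′ q₁ q₂ q₃) =
  near (e + e′) (f + f′) (k + k′) (l + l′) (y + y′)
    (trans (+-interchange e e′ f f′) (cong₂ _+_ p₁ q₁))
    (trans (+-interchange k k′ l l′) (trans (cong₂ _+_ p₂ q₂) (ring₁ s t y y′)))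
    (+-cancelˡ-≡ (2 * b) _ _ (begin
      2 * b + (2 * c + (e + e′) + N * (k + k′))           ≡⟨ ring₂ b c e e′ N k k′ ⟩
      (2 * b + e + N * k) + (2 * c + e′ + N * k′)         ≡⟨ cong₂ _+_ p₃ q₃ ⟩
      (2 * a + f + N * l) + (2 * b + f′ + N * l′)         ≡⟨ ring₃ a b f f′ N l l′ ⟩
      2 * b + (2 * a + (f + f′) + N * (l + l′))           ∎))
  where
  open ≡-Reasoning
  +-interchange : ∀ w x y z → (w + x) + (y + z) ≡ (w + y) + (x + z)
  +-interchange = solve-∀
  ring₁ : ∀ s t y y′ → (s + 2 * y) + (t + 2 * y′) ≡ s + t + 2 * (y + y′)
  ring₁ = solve-∀
  ring₂ : ∀ b c e e′ N k k′ → 2 * b + (2 * c + (e + e′) + N * (k + k′))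
                            ≡ (2 * b + e + N * k) + (2 * c + e′ + N * k′)
  ring₂ = solve-∀
  ring₃ : ∀ a b f f′ N l l′ → (2 * a + f + N * l) + (2 * b + f′ + N * l′)
                            ≡ 2 * b + (2 * a + (f + f′) + N * (l + l′))
  ring₃ = solve-∀

-- Since differences are doubled, a multiple of N appears as an even winding, as length 0 requires.
near-congruent : ∀ {N a b} j → a ≡ b + N * j → Near N 0 a b
near-congruent {N} {a} {b} j refl = near 0 0 (2 * j) 0 j refl (+-identityʳ (2 * j)) (ring b N j)
  where
  ring : ∀ b N j → 2 * b + 0 + N * (2 * j) ≡ 2 * (b + N * j) + 0 + N * 0
  ring = solve-∀

near-mod : ∀ {N} a .{{_ : NonZero N}} → Near N 0 a (a % N)
near-mod {N} a = near-congruent (a / N) (trans (m≡m%n+[m/n]*n a N) (cong (a % N +_) (*-comm (a / N) N)))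

near-refl : ∀ {N} a → Near N 0 a a
near-refl a = near 0 0 0 0 0 refl refl refl

-- With N = 2m+1, the differences m and m+1 of the odd cycle double to N - 1 and N + 1: one winding
-- and one sign each.
near-step⁻ : ∀ {m a b} → b ≡ a + m → Near (suc (2 * m)) 1 a b
near-step⁻ {m} {a} refl = near 1 0 0 1 0 refl refl (ring a m)
  where
  ring : ∀ a m → 2 * (a + m) + 1 + suc (2 * m) * 0 ≡ 2 * a + 0 + suc (2 * m) * 1
  ring = solve-∀

near-step⁺ : ∀ {m a b} → b ≡ suc (a + m) → Near (suc (2 * m)) 1 a b
near-step⁺ {m} {a} refl = near 0 1 0 1 0 refl refl (ring a m)
  where
  ring : ∀ a m → 2 * suc (a + m) + 0 + suc (2 * m) * 0 ≡ 2 * a + 1 + suc (2 * m) * 1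
  ring = solve-∀

near-walk : ∀ {N} {H : Graph} (h : V H → ℕ) → (∀ x y → E H x y → Near N 1 (h x) (h y)) →
            ∀ {len x y} → Walk H len x y → Near N len (h x) (h y)
near-walk h hE here = near-refl (h _)
near-walk h hE (step xy w) = near-trans (hE _ _ xy) (near-walk h hE w)

-- Here l − k is odd; its absolute value is 1, since otherwise |2(b − a)| > 2N.
near⇒arc-≤ : ∀ {s d a b} → 1 ≤ d → let N = suc (2 * (s + d)) in b < N →
  (nr : Near N (suc (2 * s)) a b) → Near.k nr ≤ Near.l nr → Arc N d a b
near⇒arc-≤ {s} {d} {a} {b} 1≤d b<N (near e f k l y signs winding balance) k≤l
  with m≤n⇒∃[o]m+o≡n k≤l
... | i , refl = odd i winding′ balance′
  where
  N = suc (2 * (s + d))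
  winding′ : 2 * k + i ≡ suc (2 * (s + y))
  winding′ = begin
    2 * k + i                ≡⟨ solve (k ∷ i ∷ []) ⟩
    k + (k + i)              ≡⟨ winding ⟩
    suc (2 * s) + 2 * y      ≡⟨ solve (s ∷ y ∷ []) ⟩
    suc (2 * (s + y))        ∎
    where open ≡-Reasoning
  balance′ : 2 * b + e ≡ 2 * a + f + N * i
  balance′ = +-cancelʳ-≡ (N * k) _ _ (trans balance (ring a f N k i))
    where
    ring : ∀ a f N k i → 2 * a + f + N * (k + i) ≡ 2 * a + f + N * i + N * k
    ring = solve-∀
  e≤ : e ≤ suc (2 * s)
  e≤ = ≤-trans (m≤m+n e f) (≤-reflexive signs)
  f≤ : f ≤ suc (2 * s)
  f≤ = ≤-trans (m≤n+m f e) (≤-reflexive signs)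
  odd : ∀ i → 2 * k + i ≡ suc (2 * (s + y)) → 2 * b + e ≡ 2 * a + f + N * i → Arc N d a b
  odd zero par _ = ⊥-elim (even≢odd k (s + y) (trans (sym (+-identityʳ (2 * k))) par))
  -- Now 2(b - a) = N + f - e with e and f at most 2s+1 = N - 2d, so b - a lies between d and N - d.
  odd (suc zero) _ bal =
      *-cancelˡ-≤ 2 (+-cancelʳ-≤ (suc (2 * s)) _ _ (begin
        2 * (a + d) + suc (2 * s)    ≡⟨ ring₁ a d s ⟩
        2 * a + N * 1                ≤⟨ +-monoˡ-≤ (N * 1) (m≤m+n (2 * a) f) ⟩
        2 * a + f + N * 1            ≡⟨ bal ⟨
        2 * b + e                    ≤⟨ +-monoʳ-≤ (2 * b) e≤ ⟩
        2 * b + suc (2 * s)          ∎))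
    , *-cancelˡ-≤ 2 (begin
        2 * (b + d)                          ≡⟨ *-distribˡ-+ 2 b d ⟩
        2 * b + 2 * d                        ≤⟨ +-monoˡ-≤ (2 * d) (m≤m+n (2 * b) e) ⟩
        2 * b + e + 2 * d                    ≡⟨ cong (_+ 2 * d) bal ⟩
        2 * a + f + N * 1 + 2 * d            ≤⟨ +-monoˡ-≤ (2 * d) (+-monoˡ-≤ (N * 1) (+-monoʳ-≤ (2 * a) f≤)) ⟩
        2 * a + suc (2 * s) + N * 1 + 2 * d  ≡⟨ ring₂ a s d ⟩
        2 * (a + N)                          ∎)
    where
    open ≤-Reasoning
    ring₁ : ∀ a d s → 2 * (a + d) + suc (2 * s) ≡ 2 * a + suc (2 * (s + d)) * 1
    ring₁ = solve-∀
    ring₂ : ∀ a s d → 2 * a + suc (2 * s) + suc (2 * (s + d)) * 1 + 2 * d ≡ 2 * (a + suc (2 * (s + d)))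
    ring₂ = solve-∀
  odd (suc (suc zero)) par _ = ⊥-elim (even≢odd (suc k) (s + y) (trans (*-suc 2 k) (trans (+-comm 2 (2 * k)) par)))
  odd (suc (suc (suc i))) _ bal = ⊥-elim (<-irrefl bal (begin-strict
    2 * b + e                        <⟨ +-mono-≤-< (*-monoʳ-≤ 2 (<⇒≤ b<N)) (≤-<-trans e≤ (s≤s (*-monoʳ-< 2 (m<m+n s 1≤d)))) ⟩
    2 * N + N                        ≡⟨ ring N ⟩
    N * 3                            ≤⟨ *-monoʳ-≤ N (m≤m+n 3 i) ⟩
    N * (3 + i)                      ≤⟨ m≤n+m (N * (3 + i)) (2 * a + f) ⟩
    2 * a + f + N * (3 + i)          ∎))
    where
    open ≤-Reasoning
    ring : ∀ N → 2 * N + N ≡ N * 3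
    ring = solve-∀

-- Serves both directions: with `s` = r and `d` = 2r+1 it separates the ends of an edge of the
-- power, and with `d` = m - s the ends of a subdivided edge.
near⇒apart : ∀ {N s d a b} → N ≡ suc (2 * (s + d)) → 1 ≤ d → a < N → b < N →
             Near N (suc (2 * s)) a b → Apart N d a b
near⇒apart {s = s} {a = a} {b} refl 1≤d a<N b<N nr with ≤-total (Near.k nr) (Near.l nr)
... | inj₁ k≤l = arcs⇒apart a b (inj₁ (near⇒arc-≤ {s} 1≤d b<N nr k≤l))
... | inj₂ l≤k = arcs⇒apart a b (inj₂ (near⇒arc-≤ {s} 1≤d a<N (near-sym nr) l≤k))

-- Subdivisions and 2-colourings

colors-raise : ∀ {H i j} → i ≤ j → Colorable H i → Colorable H j
colors-raise i≤j (c , ok) = (λ x → inject≤ (c x) i≤j) , λ x y xy eq → ok x y xy (inject≤-injective i≤j i≤j _ _ eq)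

subdivide-sym : ∀ {G t} → Symmetric (E (Subdivide G t))
subdivide-sym (e , i , i<t , inj₁ p) = e , i , i<t , inj₂ p
subdivide-sym (e , i , i<t , inj₂ p) = e , i , i<t , inj₁ p

pathVertex-inner : ∀ G t e {i} (i<t : i < t) → pathVertex G (suc t) e (suc i) ≡ inj₂ (e , fromℕ< i<t)
pathVertex-inner G t e {i} i<t with i <? t
... | yes p = cong (λ j → inj₂ (e , j)) (fromℕ<-cong i i refl p i<t)
... | no ¬p = ⊥-elim (¬p i<t)

pathVertex-last : ∀ G t (e : Edge G) → pathVertex G (suc t) e (suc t) ≡ inj₁ (proj₁ (proj₂ e))
pathVertex-last G t e with t <? t
... | yes p = ⊥-elim (<-irrefl refl p)
... | no  _ = refl

pathWalk : ∀ G t e j i → i + j ≤ t → Walk (Subdivide G t) j (pathVertex G t e i) (pathVertex G t e (i + j))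
pathWalk G t e zero i _ rewrite +-identityʳ i = here
pathWalk G t e (suc j) i le rewrite +-suc i j =
  step (e , i , m+n≤o⇒m≤o (suc i) le , inj₁ (refl , refl)) (pathWalk G t e j (suc i) le)

edgeWalk : ∀ G t (e : Edge G) → Walk (Subdivide G (suc t)) (suc t) (inj₁ (proj₁ e)) (inj₁ (proj₁ (proj₂ e)))
edgeWalk G t e = subst (Walk _ _ _) (pathVertex-last G t e) (pathWalk G (suc t) e (suc t) 0 ≤-refl)

by-edges : ∀ {G} {P : Fin (n G) → Fin (n G) → Set} → Symmetric P →
           (∀ (e : Edge G) → P (proj₁ e) (proj₁ (proj₂ e))) → ∀ u v → adj G u v ≡ true → P u v
by-edges {G} P-sym P-edge u v uv with <-cmp (toℕ u) (toℕ v)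
... | tri< u<v _ _ = P-edge (u , v , u<v , uv)
... | tri> _ _ v<u = P-sym (P-edge (v , u , v<u , trans (SimpleGraph.sym G v u) uv))
... | tri≈ _ u≡v _ = ⊥-elim (irrfl G u (subst (λ w → adj G u w ≡ true) (sym (toℕ-injective u≡v)) uv))

module _ {H : Graph} (H-sym : Symmetric (E H)) where

  -- Each turn goes to y and back before the walk starts.
  pad : ∀ {x y z l} → E H x y → Walk H l x z → ∀ i → Walk H (2 * i + l) x z
  pad xy w zero = w
  pad {x} {z = z} {l} xy w (suc i) =
    subst (λ len → Walk H (len + l) x z) (sym (*-suc 2 i)) (step xy (step (H-sym xy) (pad xy w i)))

  edge⇒odd-walk : ∀ {x y} → E H x y → ∀ i → Walk H (suc (2 * i)) x y
  edge⇒odd-walk {x} {y} xy i =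
    subst (λ len → Walk H len x y) (+-comm (2 * i) 1) (pad xy (step xy here) i)

fin2-≢ : {i j k : Fin 2} → i ≢ j → j ≢ k → i ≡ k
fin2-≢ {0F} {0F}      i≢j j≢k = ⊥-elim (i≢j refl)
fin2-≢ {_}  {0F} {0F} i≢j j≢k = ⊥-elim (j≢k refl)
fin2-≢ {1F} {0F} {1F} i≢j j≢k = refl
fin2-≢ {1F} {1F}      i≢j j≢k = ⊥-elim (i≢j refl)
fin2-≢ {_}  {1F} {1F} i≢j j≢k = ⊥-elim (j≢k refl)
fin2-≢ {0F} {1F} {0F} i≢j j≢k = refl

odd-walk-2-colors : ∀ {H} (c : V H → Fin 2) → (∀ x y → E H x y → c x ≢ c y) →
                    ∀ i {x y} → Walk H (suc (2 * i)) x y → c x ≢ c y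
odd-walk-2-colors c ok zero (step xy here) = ok _ _ xy
odd-walk-2-colors {H} c ok (suc i) {x} {z} w with subst (λ len → Walk H (suc len) x z) (*-suc 2 i) w
... | step xy (step yz w′) =
  subst (_≢ c z) (sym (fin2-≢ (ok _ _ xy) (ok _ _ yz))) (odd-walk-2-colors c ok i w′)

-- Going back and forth makes every edge of the subdivision an edge of the odd power, so the
-- colouring is proper on the subdivision. An edge of G is an odd walk there, and two colours
-- alternate along it.
fracPow-2-colorable : ∀ G r s → Colorable (FracPow G r s) 2 → Colorable (toGraph G) 2
fracPow-2-colorable G r s (c , ok) = c ∘ inj₁ ,
  by-edges {G} {λ u v → c (inj₁ u) ≢ c (inj₁ v)} ≢-sym
    (λ e → odd-walk-2-colors c edge-ok s (edgeWalk G (2 * s) e))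
  where
  edge-ok : ∀ x y → E (Subdivide G (suc (2 * s))) x y → c x ≢ c y
  edge-ok x y xy = ok x y (edge⇒odd-walk subdivide-sym xy r)

3-colorable⇒3-chromatic : ∀ {G} → NonBipartite G → ∀ r s →
  Colorable (FracPow G r s) 3 → ChromaticNumber (FracPow G r s) 3
3-colorable⇒3-chromatic {G} nb r s col = col , λ j j<3 colj →
  nb (fracPow-2-colorable G r s (colors-raise (s≤s⁻¹ j<3) colj))

-- From circular colourings to 3-colourings of fractional powers

⊓-suc : ∀ i g → (suc i ⊓ g ≡ i ⊓ g) ⊎ (suc i ⊓ g ≡ suc (i ⊓ g))
⊓-suc zero    zero    = inj₁ refl
⊓-suc zero    (suc g) = inj₂ refl
⊓-suc (suc i) zero    = inj₁ refl
⊓-suc (suc i) (suc g) with ⊓-suc i g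
... | inj₁ eq = inj₁ (cong suc eq)
... | inj₂ eq = inj₂ (cong suc eq)

-- A walk of length 2s+1 from a to b modulo 2m+1 whose first g steps are +(m+1) and
-- whose remaining steps are +m.
record Jump (m s a b : ℕ) : Set where
  constructor jump
  field
    g y    : ℕ
    g≤     : g ≤ suc (2 * s)
    arrive : a + m + g ≡ s + b + suc (2 * m) * y

-- As 2m ≡ -1 modulo N, the walk advances by m + g - s = d + g. Hence g = b - a - d, and the upper
-- bound of the arc keeps it at most 2s+1.
arc⇒jump : ∀ {s d a b} → Arc (suc (2 * (s + d))) d a b → Jump (s + d) s a b
arc⇒jump {s} {d} {a} {b} (lo , hi) with m≤n⇒∃[o]m+o≡n lo
... | g , refl = jump g 0
  (+-cancelˡ-≤ (a + 2 * d) g (suc (2 * s)) (subst₂ _≤_ (ring₁ a d g) (ring₂ a s d) hi))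
  (ring₃ a s d g)
  where
  ring₁ : ∀ a d g → a + d + g + d ≡ a + 2 * d + g
  ring₁ = solve-∀
  ring₂ : ∀ a s d → a + suc (2 * (s + d)) ≡ a + 2 * d + suc (2 * s)
  ring₂ = solve-∀
  ring₃ : ∀ a s d g → a + (s + d) + g ≡ s + (a + d + g) + suc (2 * (s + d)) * 0
  ring₃ = solve-∀

-- Here b lies behind a, so the walk completes one turn: `y` = 1, and the two bounds of the arc
-- exchange their roles.
arc⇒jump-back : ∀ {s d a b} → Arc (suc (2 * (s + d))) d b a → Jump (s + d) s a b
arc⇒jump-back {s} {d} {a} {b} (lo , hi) with m≤n⇒∃[o]m+o≡n hi
... | g , eq = jump g 1
  (+-cancelˡ-≤ (b + 2 * d) g (suc (2 * s)) (begin
    b + 2 * d + g              ≡⟨ ring₁ b d g ⟩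
    b + d + (d + g)            ≤⟨ +-monoˡ-≤ (d + g) lo ⟩
    a + (d + g)                ≡⟨ +-assoc a d g ⟨
    a + d + g                  ≡⟨ eq ⟩
    b + suc (2 * (s + d))      ≡⟨ ring₂ b s d ⟩
    b + 2 * d + suc (2 * s)    ∎))
  (begin-equality
    a + (s + d) + g                        ≡⟨ ring₃ a s d g ⟩
    s + (a + d + g)                        ≡⟨ cong (s +_) eq ⟩
    s + (b + suc (2 * (s + d)))            ≡⟨ ring₄ b s d ⟩
    s + b + suc (2 * (s + d)) * 1          ∎)
  where
  open ≤-Reasoning
  ring₁ : ∀ b d g → b + 2 * d + g ≡ b + d + (d + g)
  ring₁ = solve-∀
  ring₂ : ∀ b s d → b + suc (2 * (s + d)) ≡ b + 2 * d + suc (2 * s)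
  ring₂ = solve-∀
  ring₃ : ∀ a s d g → a + (s + d) + g ≡ s + (a + d + g)
  ring₃ = solve-∀
  ring₄ : ∀ b s d → s + (b + suc (2 * (s + d))) ≡ s + b + suc (2 * (s + d)) * 1
  ring₄ = solve-∀

module _ {G : SimpleGraph} {m s : ℕ} (h : Fin (n G) → ℕ)
         (jumps : ∀ u v → adj G u v ≡ true → Jump m s (h u) (h v)) where

  private
    N = suc (2 * m)
    S = Subdivide G (suc (2 * s))

  edgeJump : (e : Edge G) → Jump m s (h (proj₁ e)) (h (proj₁ (proj₂ e)))
  edgeJump (u , v , _ , uv) = jumps u v uv

  -- The term with `⊓` adds the extra unit of each of the first g steps. Values are not reduced
  -- modulo N, since `Near` absorbs multiples of N.
  onPath : Edge G → ℕ → ℕ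
  onPath e i = h (proj₁ e) + m * i + i ⊓ Jump.g (edgeJump e)

  position : V S → ℕ
  position (inj₁ u)       = h u
  position (inj₂ (e , i)) = onPath e (suc (toℕ i))

  onPath-step : ∀ e i → Near N 1 (onPath e i) (onPath e (suc i))
  onPath-step e i with ⊓-suc i (Jump.g (edgeJump e))
  ... | inj₁ eq = near-step⁻ (trans (cong (h (proj₁ e) + m * suc i +_) eq) (ring (h (proj₁ e)) m i (i ⊓ Jump.g (edgeJump e))))
    where
    ring : ∀ a m i x → a + m * suc i + x ≡ a + m * i + x + m
    ring = solve-∀
  ... | inj₂ eq = near-step⁺ (trans (cong (h (proj₁ e) + m * suc i +_) eq) (ring (h (proj₁ e)) m i (i ⊓ Jump.g (edgeJump e))))
    where
    ring : ∀ a m i x → a + m * suc i + suc x ≡ suc (a + m * i + x + m)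
    ring = solve-∀

  onPath-last : ∀ e → Near N 0 (onPath e (suc (2 * s))) (h (proj₁ (proj₂ e)))
  onPath-last e with edgeJump e
  -- The winding gains s because 2ms + s = sN.
  ... | jump g y g≤ arrive = near-congruent (y + s) (begin
    a + m * suc (2 * s) + suc (2 * s) ⊓ g      ≡⟨ cong (a + m * suc (2 * s) +_) (m≥n⇒m⊓n≡n g≤) ⟩
    a + m * suc (2 * s) + g                    ≡⟨ ring₁ a m s g ⟩
    a + m + g + 2 * m * s                      ≡⟨ cong (_+ 2 * m * s) arrive ⟩
    s + b + suc (2 * m) * y + 2 * m * s        ≡⟨ ring₂ b m s y ⟩
    b + suc (2 * m) * (y + s)                  ∎)
    where
    open ≡-Reasoning
    a = h (proj₁ e)
    b = h (proj₁ (proj₂ e))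
    ring₁ : ∀ a m s g → a + m * suc (2 * s) + g ≡ a + m + g + 2 * m * s
    ring₁ = solve-∀
    ring₂ : ∀ b m s y → s + b + suc (2 * m) * y + 2 * m * s ≡ b + suc (2 * m) * (y + s)
    ring₂ = solve-∀

  -- At its far end the path meets a vertex v of G, placed at `h v`; this agrees with `onPath` only
  -- modulo N, hence `Near N 0` instead of equality.
  position-pathVertex : ∀ e i → i ≤ suc (2 * s) →
    Near N 0 (onPath e i) (position (pathVertex G (suc (2 * s)) e i))
  position-pathVertex e zero _ = near-congruent 0 (ring (h (proj₁ e)) m)
    where
    ring : ∀ a m → a + m * 0 + 0 ≡ a + suc (2 * m) * 0
    ring = solve-∀
  position-pathVertex e (suc i) (s≤s i≤) with m≤n⇒m<n∨m≡n i≤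
  ... | inj₁ i< = subst (λ x → Near N 0 (onPath e (suc i)) (position x)) (sym (pathVertex-inner G (2 * s) e i<))
                    (subst (λ j → Near N 0 (onPath e (suc i)) (onPath e (suc j))) (sym (toℕ-fromℕ< i<)) (near-refl _))
  ... | inj₂ refl = subst (λ x → Near N 0 (onPath e (suc i)) (position x)) (sym (pathVertex-last G (2 * s) e))
                    (onPath-last e)

  position-edge : ∀ x y → E S x y → Near N 1 (position x) (position y)
  position-edge x y (e , i , i<t , orient) = go orient
    where
    along : Near N 1 (position (pathVertex G (suc (2 * s)) e i)) (position (pathVertex G (suc (2 * s)) e (suc i)))
    along = near-trans (near-sym (position-pathVertex e i (<⇒≤ i<t)))
              (near-trans (onPath-step e i) (position-pathVertex e (suc i) i<t))
    go : _ → _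
    go (inj₁ (refl , refl)) = along
    go (inj₂ (refl , refl)) = near-sym along

  -- The colour is the arc of length 2r+1 containing the position. Two positions in one arc are less
  -- than 2r+1 apart, while the ends of a walk of length 2r+1 are at least that far apart.
  jumps⇒3-colorable : ∀ r → N ≡ 3 * suc (2 * r) → Colorable (FracPow G r s) 3
  jumps⇒3-colorable r N≡ = colour , proper
    where
    pos : V S → ℕ
    pos x = position x % N
    pos< : ∀ x → pos x < N
    pos< x = m%n<n (position x) N
    quot< : ∀ x → pos x / suc (2 * r) < 3
    quot< x = m<n*o⇒m/o<n (subst (pos x <_) N≡ (pos< x))
    colour : V S → Fin 3
    colour x = fromℕ< (quot< x)
    width : N ≡ suc (2 * (r + suc (2 * r)))
    width = trans N≡ (solve (r ∷ []))
    proper : ∀ x y → Walk S (suc (2 * r)) x y → colour x ≢ colour y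
    proper x y w eq = <⇒≱ (close x y same)
        (proj₁ (near⇒apart {N} {r} {suc (2 * r)} width (s≤s z≤n) (pos< x) (pos< y) nr))
      where
      nr : Near N (suc (2 * r)) (pos x) (pos y)
      nr = subst (λ len → Near N len (pos x) (pos y)) (+-identityʳ (suc (2 * r)))
             (near-trans (near-sym (near-mod (position x)))
               (near-trans (near-walk position position-edge w) (near-mod (position y))))
      same : pos x / suc (2 * r) ≡ pos y / suc (2 * r)
      same = trans (sym (toℕ-fromℕ< (quot< x))) (trans (cong toℕ eq) (toℕ-fromℕ< (quot< y)))
      close : ∀ x y → pos x / suc (2 * r) ≡ pos y / suc (2 * r) → ∣ pos x - pos y ∣ < suc (2 * r)
      close x y q≡ = subst (_< suc (2 * r)) (sym dist)
          (≤-<-trans (∣m-n∣≤m⊔n (pos x % L) (pos y % L)) (⊔-pres-<m (m%n<n (pos x) L) (m%n<n (pos y) L)))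
        where
        L = suc (2 * r)
        dist : ∣ pos x - pos y ∣ ≡ ∣ pos x % L - pos y % L ∣
        dist = begin
          ∣ pos x - pos y ∣                                          ≡⟨ cong₂ ∣_-_∣ (m≡m%n+[m/n]*n (pos x) L) (m≡m%n+[m/n]*n (pos y) L) ⟩
          ∣ pos x % L + pos x / L * L - pos y % L + pos y / L * L ∣  ≡⟨ cong (λ z → ∣ pos x % L + z * L - pos y % L + pos y / L * L ∣) q≡ ⟩
          ∣ pos x % L + pos y / L * L - pos y % L + pos y / L * L ∣  ≡⟨ cong₂ ∣_-_∣ (+-comm (pos x % L) _) (+-comm (pos y % L) _) ⟩
          ∣ pos y / L * L + pos x % L - pos y / L * L + pos y % L ∣  ≡⟨ ∣m+n-m+o∣≡∣n-o∣ (pos y / L * L) (pos x % L) (pos y % L) ⟩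
          ∣ pos x % L - pos y % L ∣                                  ∎
          where open ≡-Reasoning

circ⇒3-colorable : ∀ {G} r s d → s + d ≡ suc (3 * r) → CircColorable G (3 * suc (2 * r)) d → Colorable (FracPow G r s) 3
circ⇒3-colorable {G} r s d s+d≡ (c , ok) = jumps⇒3-colorable (toℕ ∘ c) jumps r N≡
  where
  N≡ : suc (2 * (s + d)) ≡ 3 * suc (2 * r)
  N≡ = trans (cong (λ m → suc (2 * m)) s+d≡) (solve (r ∷ []))
  d≤ : d ≤ suc (2 * (s + d))
  d≤ = m≤n⇒m≤1+n (≤-trans (m≤n+m d s) (m≤n*m (s + d) 2))
  jumps : ∀ u v → adj G u v ≡ true → Jump (s + d) s (toℕ (c u)) (toℕ (c v))
  jumps u v uv with apart⇒arc (toℕ (c u)) (toℕ (c v)) d≤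
                        (subst (λ N → Apart N d (toℕ (c u)) (toℕ (c v))) (sym N≡) (ok u v uv))
  ... | inj₁ a = arc⇒jump {s} {d} a
  ... | inj₂ a = arc⇒jump-back {s} {d} a

-- The target odd cycle is so short that every vertex lies on a closed walk of length 2s+1.
long⇒3-colorable : ∀ {G} r s → suc (3 * r) ≤ s → Colorable (FracPow G r s) 3
long⇒3-colorable {G} r s m≤s = jumps⇒3-colorable {m = suc (3 * r)} {s} (λ _ → 0)
  (λ _ _ _ → jump (s ∸ suc (3 * r)) 0 (≤-trans (m∸n≤m s (suc (3 * r))) (m≤n⇒m≤1+n (m≤n*m s 2)))
     (trans (m+[n∸m]≡n m≤s) (ring₁ s (suc (2 * suc (3 * r)))))) r (ring₂ r)
  where
  ring₁ : ∀ s N → s ≡ s + 0 + N * 0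
  ring₁ = solve-∀
  ring₂ : ∀ r → suc (2 * suc (3 * r)) ≡ 3 * suc (2 * r)
  ring₂ = solve-∀

-- From 3-colourings of fractional powers to circular colourings

bit : Bool → ℕ
bit true  = 1
bit false = 0

count : (ℕ → Bool) → ℕ → ℕ
count f zero    = 0
count f (suc r) = bit (f r) + count f r

bit-mono : ∀ {a b} → (a ≡ true → b ≡ true) → bit a ≤ bit b
bit-mono {false} a⇒b = z≤n
bit-mono {true}  a⇒b rewrite a⇒b refl = ≤-refl

bit≤1 : ∀ b → bit b ≤ 1
bit≤1 true  = ≤-refl
bit≤1 false = z≤n

count≤ : ∀ f r → count f r ≤ r
count≤ f zero    = z≤n
count≤ f (suc r) = +-mono-≤ (bit≤1 (f r)) (count≤ f r)

count-all : ∀ f r → (∀ k → k < r → f k ≡ true) → count f r ≡ r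
count-all f zero    all = refl
count-all f (suc r) all rewrite all r ≤-refl = cong suc (count-all f r λ k k<r → all k (m≤n⇒m≤1+n k<r))

count-none : ∀ f r → (∀ k → k < r → f k ≡ false) → count f r ≡ 0
count-none f zero    none = refl
count-none f (suc r) none rewrite none r ≤-refl = count-none f r λ k k<r → none k (m≤n⇒m≤1+n k<r)

count-mono : ∀ f g r → (∀ k → k < r → f k ≡ true → g k ≡ true) → count f r ≤ count g r
count-mono f g zero    f⇒g = z≤n
count-mono f g (suc r) f⇒g = +-mono-≤ (bit-mono (f⇒g r ≤-refl)) (count-mono f g r λ k k<r → f⇒g k (m≤n⇒m≤1+n k<r))

-- Every index counted for `g` is matched with the next index for `f`, except the last one, r - 1,
-- which accounts for the 1.
count-shift : ∀ f g r → (∀ k → suc k < r → g k ≡ true → f (suc k) ≡ true) → count g r ≤ suc (count f r)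
count-shift f g zero    g⇒f = z≤n
count-shift f g (suc r) g⇒f = +-mono-≤ (bit≤1 (g r)) (go r λ k k<r → g⇒f k (s≤s k<r))
  where
  go : ∀ r → (∀ k → k < r → g k ≡ true → f (suc k) ≡ true) → count g r ≤ count f (suc r)
  go zero    g⇒f = z≤n
  go (suc r) g⇒f = +-mono-≤ (bit-mono (g⇒f r ≤-refl)) (go r λ k k<r → g⇒f k (m≤n⇒m≤1+n k<r))

next : Fin 3 → Fin 3
next 0F = 1F
next 1F = 2F
next 2F = 0F

next³ : ∀ a → next (next (next a)) ≡ a
next³ 0F = refl
next³ 1F = refl
next³ 2F = refl

≢⇒next : ∀ a b → a ≢ b → (b ≡ next a) ⊎ (a ≡ next b)
≢⇒next 0F 0F a≢b = ⊥-elim (a≢b refl)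
≢⇒next 0F 1F a≢b = inj₁ refl
≢⇒next 0F 2F a≢b = inj₂ refl
≢⇒next 1F 0F a≢b = inj₂ refl
≢⇒next 1F 1F a≢b = ⊥-elim (a≢b refl)
≢⇒next 1F 2F a≢b = inj₁ refl
≢⇒next 2F 0F a≢b = inj₁ refl
≢⇒next 2F 1F a≢b = inj₂ refl
≢⇒next 2F 2F a≢b = ⊥-elim (a≢b refl)

-- One arc plus r or r+1 is m or m+1 for m = 3r+1. From colour 2 to colour 0 the level instead drops
-- by m+1 or m, the same kind of step read backwards.
arc-step : ∀ r a {o o′} → (o′ ≡ o + r) ⊎ (o′ ≡ suc (o + r)) →
           Near (3 * suc (2 * r)) 1 (suc (2 * r) * toℕ a + o) (suc (2 * r) * toℕ (next a) + o′)
arc-step r a {o} {o′} δ = subst (λ N → Near N 1 (suc (2 * r) * toℕ a + o) (suc (2 * r) * toℕ (next a) + o′)) (ring r) (go a δ)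
  where
  ring : ∀ r → suc (2 * suc (3 * r)) ≡ 3 * suc (2 * r)
  ring = solve-∀
  go : ∀ a → (o′ ≡ o + r) ⊎ (o′ ≡ suc (o + r)) →
       Near (suc (2 * suc (3 * r))) 1 (suc (2 * r) * toℕ a + o) (suc (2 * r) * toℕ (next a) + o′)
  go 0F (inj₁ refl) = near-step⁻ {suc (3 * r)} (solve (r ∷ o ∷ []))
  go 0F (inj₂ refl) = near-step⁺ {suc (3 * r)} (solve (r ∷ o ∷ []))
  go 1F (inj₁ refl) = near-step⁻ {suc (3 * r)} (solve (r ∷ o ∷ []))
  go 1F (inj₂ refl) = near-step⁺ {suc (3 * r)} (solve (r ∷ o ∷ []))
  go 2F (inj₁ refl) = near-sym (near-step⁺ {suc (3 * r)} (solve (r ∷ o ∷ [])))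
  go 2F (inj₂ refl) = near-sym (near-step⁻ {suc (3 * r)} (solve (r ∷ o ∷ [])))

-- The bound on l leaves only finitely many instances to decide.
Sees : (H : Graph) (r : ℕ) → (V H → Fin 3) → V H → Fin 3 → ℕ → Set
Sees H r c x a l = l ≤ 2 * r × Σ (V H) λ z → Walk H l x z × c z ≡ a

module _ {H : Graph} (H-sym : Symmetric (E H)) (r : ℕ) (c : V H → Fin 3)
         (proper : ∀ x y → Walk H (suc (2 * r)) x y → c x ≢ c y)
         (sees? : ∀ x a l → Dec (Sees H r c x a l)) where

  seen : V H → Fin 3 → ℕ → Bool
  seen x a l = does (sees? x a l)

  -- Applying `next` twice gives the preceding colour.
  below above : V H → ℕ → Bool
  below x k = seen x (next (next (c x))) (suc (2 * k))
  above x k = seen x (next (c x)) (suc (suc (2 * k)))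

  offset : V H → ℕ
  offset x = count (below x) r + count (above x) r

  level : V H → ℕ
  level x = suc (2 * r) * toℕ (c x) + offset x

  level< : ∀ x → level x < 3 * suc (2 * r)
  level< x = begin-strict
    suc (2 * r) * toℕ (c x) + offset x      <⟨ +-mono-≤-< (*-monoʳ-≤ (suc (2 * r)) (s≤s⁻¹ (toℕ<n (c x)))) offset< ⟩
    suc (2 * r) * 2 + suc (2 * r)           ≡⟨ ring (suc (2 * r)) ⟩
    3 * suc (2 * r)                         ∎
    where
    open ≤-Reasoning
    offset< : offset x < suc (2 * r)
    offset< = s≤s (≤-trans (+-mono-≤ (count≤ (below x) r) (count≤ (above x) r)) (≤-reflexive (cong (r +_) (sym (+-identityʳ r)))))
    ring : ∀ L → L * 2 + L ≡ 3 * L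
    ring = solve-∀

  seen-intro : ∀ {x a l} → Sees H r c x a l → seen x a l ≡ true
  seen-intro {x} {a} {l} = dec-true (sees? x a l)

  seen-elim : ∀ {x a l} → seen x a l ≡ true → Sees H r c x a l
  seen-elim {x} {a} {l} eq with yes p ← sees? x a l = p

  seen-step : ∀ {x y a l} → E H x y → suc l ≤ 2 * r → seen x a l ≡ true → seen y a (suc l) ≡ true
  seen-step xy l≤ sx with seen-elim sx
  ... | _ , z , w , cz = seen-intro (l≤ , z , step (H-sym xy) w , cz)

  double≤ : ∀ {k} → k < r → suc (suc (2 * k)) ≤ 2 * r
  double≤ {k} k<r = subst (_≤ 2 * r) (*-suc 2 k) (*-monoʳ-≤ 2 k<r)

  -- Such a walk, prefixed by the edge from y to x and padded along it, would join y by a walk of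
  -- length 2r+1 to a vertex of the same colour.
  neighbour-not-seen : ∀ {x y} → E H x y → ∀ k → k < r → seen x (c y) (suc (suc (2 * k))) ≡ false
  neighbour-not-seen {x} {y} xy k k<r = dec-false (sees? x (c y) _) λ (_ , z , w , cz) →
    proper y z (subst (λ len → Walk H len y z) length≡ (pad H-sym (H-sym xy) (step (H-sym xy) w) i)) (sym cz)
    where
    i = r ∸ suc k
    length≡ : 2 * i + suc (suc (suc (2 * k))) ≡ suc (2 * r)
    length≡ = trans (ring i k) (cong (λ z → suc (2 * z)) (m∸n+n≡m k<r))
      where
      ring : ∀ i k → 2 * i + suc (suc (suc (2 * k))) ≡ suc (2 * (i + suc k))
      ring = solve-∀

  -- The two counts that remain, `below x` and `above y`, both look for the third colour. Crossing
  -- the edge turns length 2k+1 at x into 2k+2 at y, and that into 2k+3 at x, the next index. Only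
  -- the top index of `above y` has no successor, so the counts differ by at most one.
  offset-step : ∀ {x y} → E H x y → c y ≡ next (c x) →
                (offset y ≡ offset x + r) ⊎ (offset y ≡ suc (offset x + r))
  offset-step {x} {y} xy cy = subst₂ (λ ox oy → (oy ≡ ox + r) ⊎ (oy ≡ suc (ox + r))) (sym offset-x) (sym offset-y)
      (between (count-mono (below x) (above y) r up) (count-shift (below x) (above y) r down))
    where
    third : next (c y) ≡ next (next (c x))
    third = cong next cy
    offset-x : offset x ≡ count (below x) r
    offset-x = trans (cong (count (below x) r +_) (count-none (above x) r λ k k<r →
        subst (λ a → seen x a (suc (suc (2 * k))) ≡ false) cy (neighbour-not-seen xy k k<r)))
      (+-identityʳ _)
    offset-y : offset y ≡ r + count (above y) r
    offset-y = cong (_+ count (above y) r) (count-all (below y) r λ k k<r →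
      seen-intro (≤-trans (n≤1+n _) (double≤ k<r) , x , edge⇒odd-walk H-sym (H-sym xy) k
                 , sym (trans (cong (next ∘ next) cy) (next³ (c x)))))
    up : ∀ k → k < r → below x k ≡ true → above y k ≡ true
    up k k<r sx = subst (λ a → seen y a (suc (suc (2 * k))) ≡ true) (sym third) (seen-step xy (double≤ k<r) sx)
    down : ∀ k → suc k < r → above y k ≡ true → below x (suc k) ≡ true
    down k k<r sy = subst₂ (λ a l → seen x a (suc l) ≡ true) third (sym (*-suc 2 k))
      (seen-step (H-sym xy) (subst (λ l → suc l ≤ 2 * r) (*-suc 2 k) (≤-trans (n≤1+n _) (double≤ k<r))) sy)
    between : ∀ {p q} → p ≤ q → q ≤ suc p → (r + q ≡ p + r) ⊎ (r + q ≡ suc (p + r))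
    between {p} {q} p≤q q≤ with m≤n⇒m<n∨m≡n q≤
    ... | inj₁ q< rewrite ≤-antisym p≤q (s≤s⁻¹ q<) = inj₁ (+-comm r q)
    ... | inj₂ refl = inj₂ (+-comm r (suc p))

  level-step : ∀ {x y} → E H x y → c y ≡ next (c x) → Near (3 * suc (2 * r)) 1 (level x) (level y)
  level-step {x} {y} xy cy =
    subst (λ b → Near (3 * suc (2 * r)) 1 (level x) (suc (2 * r) * toℕ b + offset y)) (sym cy)
      (arc-step r (c x) (offset-step xy cy))

  level-edge : ∀ x y → E H x y → Near (3 * suc (2 * r)) 1 (level x) (level y)
  level-edge x y xy with ≢⇒next (c x) (c y) (proper x y (edge⇒odd-walk H-sym xy r))
  ... | inj₁ cy = level-step xy cy
  ... | inj₂ cx = near-sym (level-step (H-sym xy) cx)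

-- Deciding finitely many statements under a double negation

-- The double-negation shift for A: a form of finiteness that passes to Σ and ⊎ without enumerating
-- the type.
¬¬-Shift : Set → Set₁
¬¬-Shift A = ∀ {P : A → Set} → (∀ a → ¬ ¬ P a) → ¬ ¬ (∀ a → P a)

shift-Fin : ∀ n → ¬¬-Shift (Fin n)
shift-Fin zero    f k = k λ ()
shift-Fin (suc n) f k = f 0F λ p → shift-Fin n (f ∘ sucF) λ ps → k λ { 0F → p ; (sucF i) → ps i }

shift-Σ : ∀ {A : Set} {B : A → Set} → ¬¬-Shift A → (∀ a → ¬¬-Shift (B a)) → ¬¬-Shift (Σ A B)
shift-Σ sA sB f k = sA (λ a → sB a (λ b → f (a , b))) λ ps → k λ (a , b) → ps a b

shift-⊎ : ∀ {A B : Set} → ¬¬-Shift A → ¬¬-Shift B → ¬¬-Shift (A ⊎ B)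
shift-⊎ sA sB f k = sA (f ∘ inj₁) λ ps → sB (f ∘ inj₂) λ qs → k [ ps , qs ]

-- Handles the proof components of `Edge`: under the negation a proposition may be taken to have one
-- element or none.
shift-irrelevant : ∀ {A : Set} → Irrelevant A → ¬¬-Shift A
shift-irrelevant irr {P} f k = ¬¬-excluded-middle λ
  { (yes a) → f a λ p → k λ b → subst P (irr a b) p
  ; (no ¬a) → k λ a → ⊥-elim (¬a a) }

shift-SubV : ∀ G t → ¬¬-Shift (SubV G t)
shift-SubV G t = shift-⊎ (shift-Fin _) (shift-Σ shift-Edge λ _ → shift-Fin _)
  where
  shift-Edge : ¬¬-Shift (Edge G)
  shift-Edge = shift-Σ (shift-Fin _) λ u → shift-Σ (shift-Fin _) λ v →
    shift-Σ (shift-irrelevant <-irrelevant) λ _ → shift-irrelevant (Decidable⇒UIP.≡-irrelevant Bool._≟_)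

-- Excluded middle is taken only for l ≤ 2r, a finite family; larger l fail by the bound in `Sees`.
¬¬-sees? : ∀ H r c → ¬¬-Shift (V H) → ¬ ¬ (∀ x a l → Dec (Sees H r c x a l))
¬¬-sees? H r c sV k =
  shift-Σ sV (λ _ → shift-Σ (shift-Fin 3) λ _ → shift-Fin (suc (2 * r)))
    {λ (x , a , l) → Dec (Sees H r c x a (toℕ l))} (λ _ → ¬¬-excluded-middle)
    λ d → k λ x a l → extend x a l d
  where
  extend : ∀ x a l → (∀ i → _) → Dec (Sees H r c x a l)
  extend x a l d with l ≤? 2 * r
  ... | yes l≤ = subst (λ j → Dec (Sees H r c x a j)) (toℕ-fromℕ< (s≤s l≤)) (d (x , a , fromℕ< (s≤s l≤)))
  ... | no  l≰ = no (l≰ ∘ proj₁)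

-- The levels of the original vertices form the circular colouring, since the ends of an edge are
-- joined by a walk of length 2s+1. The double negation stems only from `¬¬-sees?`.
3-colorable⇒circ : ∀ {G} r s d → 1 ≤ d → s + d ≡ suc (3 * r) →
  Colorable (FracPow G r s) 3 → ¬ ¬ CircColorable G (3 * suc (2 * r)) d
3-colorable⇒circ {G} r s d 1≤d s+d≡ (c , proper) k =
  ¬¬-sees? S r c (shift-SubV G (suc (2 * s))) λ sees? → k (circ sees?)
  where
  S = Subdivide G (suc (2 * s))
  N≡ : 3 * suc (2 * r) ≡ suc (2 * (s + d))
  N≡ = trans (ring r) (cong (λ m → suc (2 * m)) (sym s+d≡))
    where
    ring : ∀ r → 3 * suc (2 * r) ≡ suc (2 * suc (3 * r))
    ring = solve-∀
  circ : (∀ x a l → Dec (Sees S r c x a l)) → CircColorable G (3 * suc (2 * r)) d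
  circ sees? = (λ u → fromℕ< (h< u)) , λ u v uv →
      subst₂ (Apart (3 * suc (2 * r)) d) (sym (toℕ-fromℕ< (h< u))) (sym (toℕ-fromℕ< (h< v)))
        (by-edges {G} {λ u v → Apart (3 * suc (2 * r)) d (h u) (h v)} (λ {u} {v} → apart-sym (h u) (h v))
          (λ e → near⇒apart {s = s} N≡ 1≤d (h< _) (h< _)
                   (near-walk lev (level-edge subdivide-sym r c proper sees?) (edgeWalk G (2 * s) e)))
          u v uv)
    where
    lev : V S → ℕ
    lev = level subdivide-sym r c proper sees?
    h : Fin (n G) → ℕ
    h = lev ∘ inj₁
    h< : ∀ u → h u < 3 * suc (2 * r)
    h< = level< subdivide-sym r c proper sees? ∘ inj₁

-- Ordinary colourings as maps to K_{k/1}, and comparison of fractions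

colorable⇒circ : ∀ G {k} → Colorable (toGraph G) k → CircColorable G k 1
colorable⇒circ G {k} (c , ok) = c , λ u v uv →
    n≢0⇒n>0 (λ eq → ok u v uv (toℕ-injective (∣m-n∣≡0⇒m≡n eq)))
  , m+n≤o⇒m≤o∸n ∣ toℕ (c u) - toℕ (c v) ∣ (subst (_≤ k) (+-comm 1 _)
      (≤-<-trans (∣m-n∣≤m⊔n (toℕ (c u)) (toℕ (c v))) (⊔-pres-<m (toℕ<n (c u)) (toℕ<n (c v)))))

circ⇒colorable : ∀ G {k} → CircColorable G k 1 → Colorable (toGraph G) k
circ⇒colorable G (c , ok) = c , λ u v uv eq →
  <⇒≢ (proj₁ (ok u v uv)) (sym (m≡n⇒∣m-n∣≡0 (cong toℕ eq)))

module _ {x y a b : ℕ} (eq : x + 2 * a ≡ y + 2 * b) where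

  balanced-<⇒> : x < y → b < a
  balanced-<⇒> x<y = ≰⇒> λ a≤b → <-irrefl eq (+-mono-<-≤ x<y (*-monoʳ-≤ 2 a≤b))

  balanced->⇒< : b < a → x < y
  balanced->⇒< b<a = ≰⇒> λ y≤x → <-irrefl (sym eq) (+-mono-≤-< y≤x (*-monoʳ-< 2 b<a))

  balanced-≥⇒≤ : y ≤ x → a ≤ b
  balanced-≥⇒≤ y≤x = ≮⇒≥ λ b<a → <⇒≱ (balanced->⇒< b<a) y≤x

-- (2r+1)/(2s+1) > k/(3(k−2)) amounts to 3(2r+1)/d < k for d = 3r+1−s.
threshold : ∀ k r s d → 2 ≤ k → s + d ≡ suc (3 * r) →
  k * suc (2 * s) + 2 * (k * d) ≡ suc (2 * r) * (3 * (k ∸ 2)) + 2 * (3 * suc (2 * r))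
threshold (suc (suc k)) r s d (s≤s (s≤s z≤n)) s+d≡ = begin
  (2 + k) * suc (2 * s) + 2 * ((2 + k) * d)                ≡⟨ ring₁ k s d ⟩
  (2 + k) * suc (2 * (s + d))                              ≡⟨ cong (λ m → (2 + k) * suc (2 * m)) s+d≡ ⟩
  (2 + k) * suc (2 * suc (3 * r))                          ≡⟨ ring₂ k r ⟩
  suc (2 * r) * (3 * k) + 2 * (3 * suc (2 * r))            ∎
  where
  open ≡-Reasoning
  ring₁ : ∀ k s d → (2 + k) * suc (2 * s) + 2 * ((2 + k) * d) ≡ (2 + k) * suc (2 * (s + d))
  ring₁ = solve-∀
  ring₂ : ∀ k r → (2 + k) * suc (2 * suc (3 * r)) ≡ suc (2 * r) * (3 * k) + 2 * (3 * suc (2 * r))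
  ring₂ = solve-∀

-- Ensures d = 3r+1 - s ≥ 1. For larger s, 2s+1 would be at least 3(2r+1), contradicting the
-- hypothesis because k ∸ 2 ≤ k.
above-threshold⇒short : ∀ k r s → k * suc (2 * s) < suc (2 * r) * (3 * (k ∸ 2)) → s ≤ 3 * r
above-threshold⇒short k r s lt = ≮⇒≥ λ 3r<s → <⇒≱ lt (begin
  suc (2 * r) * (3 * (k ∸ 2))      ≡⟨ ring (k ∸ 2) r ⟩
  (k ∸ 2) * suc (2 * suc (3 * r))  ≤⟨ *-mono-≤ (m∸n≤m k 2) (s≤s (*-monoʳ-≤ 2 3r<s)) ⟩
  k * suc (2 * s)                  ∎)
  where
  open ≤-Reasoning
  ring : ∀ k r → suc (2 * r) * (3 * k) ≡ k * suc (2 * suc (3 * r))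
  ring = solve-∀

2d≤3[2r+1] : ∀ r s d → s + d ≡ suc (3 * r) → 2 * d ≤ 3 * suc (2 * r)
2d≤3[2r+1] r s d s+d≡ = begin
  2 * d                  ≤⟨ *-monoʳ-≤ 2 (≤-trans (m≤n+m d s) (≤-reflexive s+d≡)) ⟩
  2 * suc (3 * r)        ≤⟨ n≤1+n _ ⟩
  suc (2 * suc (3 * r))  ≡⟨ ring r ⟩
  3 * suc (2 * r)        ∎
  where
  open ≤-Reasoning
  ring : ∀ r → suc (2 * suc (3 * r)) ≡ 3 * suc (2 * r)
  ring = solve-∀

theorem4p1 : (G : SimpleGraph) (k p q : ℕ) →
    NonBipartite G → ChromaticNumber (toGraph G) k → IsCircChromatic G p q →
    ((p ≢ k * q) ⇔ ∃₂ (λ r s → (k * suc (2 * s) < suc (2 * r) * (3 * (k ∸ 2)))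
    × ChromaticNumber (FracPow G r s) 3))
    × IsInf G p q
    × (∀ r s → suc (2 * r) * (3 * (k ∸ 2)) ≤ k * suc (2 * s) →
    ChromaticNumber (FracPow G r s) 3)
theorem4p1 G k p q nb (k-col , _) (1≤q , 2q≤p , pq-col , pq-min) =
  mk⇔ non-tight⇒powers powers⇒non-tight , (lower , greatest) , small-powers
  where
  2≤k : 2 ≤ k
  2≤k = ≮⇒≥ λ k<2 → nb (colors-raise (<⇒≤ k<2) k-col)

  q≤p : q ≤ p
  q≤p = ≤-trans (m≤n*m q 2) 2q≤p

  instance
    k≢0 : NonZero k
    k≢0 = >-nonZero (<⇒≤ 2≤k)
    q≢0 : NonZero q
    q≢0 = >-nonZero 1≤q
    p≢0 : NonZero p
    p≢0 = >-nonZero (≤-trans 1≤q q≤p)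

  2q<p : 2 * q < p
  -- Otherwise the colouring would carry over to K_{2/1}, a single edge.
  2q<p = ≰⇒> λ p≤2q → nb (circ⇒colorable G
    (circ-mono G {p′ = 2} {1} q≤p (subst (_≤ 2 * q) (sym (*-identityʳ p)) p≤2q) pq-col))

  three : ∀ r s → Colorable (FracPow G r s) 3 → ChromaticNumber (FracPow G r s) 3
  three = 3-colorable⇒3-chromatic nb

  χc≤ : ∀ r s d → 1 ≤ d → s + d ≡ suc (3 * r) → Colorable (FracPow G r s) 3 → p * d ≤ 3 * suc (2 * r) * q
  -- The goal is a decidable inequality, so the double negation can be removed here.
  χc≤ r s d 1≤d s+d≡ col = decidable-stable (_ ≤? _) λ ¬le →
    3-colorable⇒circ r s d 1≤d s+d≡ col λ circ →
      ¬le (pq-min (3 * suc (2 * r)) d 1≤d (2d≤3[2r+1] r s d s+d≡) circ)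

  -- (6p+3)/(6q) lies in [p/q , k).
  non-tight⇒powers : p ≢ k * q → ∃₂ λ r s → (k * suc (2 * s) < suc (2 * r) * (3 * (k ∸ 2)))
                                          × ChromaticNumber (FracPow G r s) 3
  non-tight⇒powers p≢kq = p , s , balanced->⇒< (threshold k p s (6 * q) 2≤k s+d≡) small , three p s
      (circ⇒3-colorable p s (6 * q) s+d≡ (circ-mono G q≤p close pq-col))
    where
    s = suc (3 * p) ∸ 6 * q
    s+d≡ : s + 6 * q ≡ suc (3 * p)
    s+d≡ = m∸n+n≡m (m≤n⇒m≤1+n (subst (_≤ 3 * p) (sym (*-assoc 3 2 q)) (*-monoʳ-≤ 3 2q≤p)))
    p<kq : p < k * q
    p<kq = ≤∧≢⇒< (subst (_≤ k * q) (*-identityʳ p)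
      (pq-min k 1 ≤-refl 2≤k (colorable⇒circ G k-col))) p≢kq
    close : p * (6 * q) ≤ 3 * suc (2 * p) * q
    close = ≤-trans (m≤m+n _ (3 * q)) (≤-reflexive (ring p q))
      where
      ring : ∀ p q → p * (6 * q) + 3 * q ≡ 3 * suc (2 * p) * q
      ring = solve-∀
    small : 3 * suc (2 * p) < k * (6 * q)
    small = begin-strict
      3 * suc (2 * p)      <⟨ m<m+n _ {3} (s≤s z≤n) ⟩
      3 * suc (2 * p) + 3  ≡⟨ ring₁ p ⟩
      6 * suc p            ≤⟨ *-monoʳ-≤ 6 p<kq ⟩
      6 * (k * q)          ≡⟨ ring₂ k q ⟩
      k * (6 * q)          ∎
      where
      open ≤-Reasoning
      ring₁ : ∀ p → 3 * suc (2 * p) + 3 ≡ 6 * suc p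
      ring₁ = solve-∀
      ring₂ : ∀ k q → 6 * (k * q) ≡ k * (6 * q)
      ring₂ = solve-∀

  powers⇒non-tight : (∃₂ λ r s → (k * suc (2 * s) < suc (2 * r) * (3 * (k ∸ 2)))
                               × ChromaticNumber (FracPow G r s) 3) → p ≢ k * q
  -- The 3-colouring gives p/q ≤ 3(2r+1)/d, and the threshold gives 3(2r+1)/d < k.
  powers⇒non-tight (r , s , lt , col , _) p≡kq = <⇒≱ big (χc≤ r s d 1≤d s+d≡ col)
    where
    s≤3r : s ≤ 3 * r
    s≤3r = above-threshold⇒short k r s lt
    d = suc (3 * r) ∸ s
    s+d≡ : s + d ≡ suc (3 * r)
    s+d≡ = m+[n∸m]≡n (m≤n⇒m≤1+n s≤3r)
    1≤d : 1 ≤ d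
    1≤d = m<n⇒0<n∸m (s≤s s≤3r)
    big : 3 * suc (2 * r) * q < p * d
    big = begin-strict
      3 * suc (2 * r) * q  <⟨ *-monoˡ-< q (balanced-<⇒> {a = k * d} (threshold k r s d 2≤k s+d≡) lt) ⟩
      k * d * q            ≡⟨ ring k d q ⟩
      k * q * d            ≡⟨ cong (_* d) p≡kq ⟨
      p * d                ∎
      where
      open ≤-Reasoning
      ring : ∀ k d q → k * d * q ≡ k * q * d
      ring = solve-∀

  thirds : ∀ t → suc (2 * suc (3 * t)) ≡ 3 * suc (2 * t)
  thirds = solve-∀

  lower : LowerBound G p q
  -- Take r = n, s = 3t+1 and d = 3(n - t), so that 3(2r+1)/d = (2n+1)/(n - t) after cancelling 3.
  lower nn t (_ , t<nn , col , _) = *-cancelˡ-≤ 3 (subst₂ _≤_ (ring₁ p (nn ∸ t)) (ring₂ nn q)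
    (χc≤ nn (suc (3 * t)) (3 * (nn ∸ t)) (*-mono-≤ {1} {3} (s≤s z≤n) (m<n⇒0<n∸m t<nn)) s+d≡
      (subst (λ l → Colorable (Pow (Subdivide G l) (suc (2 * nn))) 3) (sym (thirds t)) col)))
    where
    s+d≡ : suc (3 * t) + 3 * (nn ∸ t) ≡ suc (3 * nn)
    s+d≡ = cong suc (trans (sym (*-distribˡ-+ 3 t _)) (cong (3 *_) (m+[n∸m]≡n (<⇒≤ t<nn))))
    ring₁ : ∀ p d → p * (3 * d) ≡ 3 * (p * d)
    ring₁ = solve-∀
    ring₂ : ∀ m q → 3 * suc (2 * m) * q ≡ 3 * (suc (2 * m) * q)
    ring₂ = solve-∀

  -- The fractions (2bp+1)/(2bq) of the set tend to p/q as b grows.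
  inSet : ∀ b → 1 ≤ b → InSet G (b * p) (b * (p ∸ 2 * q))
  -- Positivity of t = b(p - 2q) rests on 2q < p, hence on G being non-bipartite.
  inSet b 1≤b = *-mono-≤ 1≤b (m<n⇒0<n∸m 2q<p) , *-monoʳ-< b {{>-nonZero 1≤b}} z<p ,
      subst (λ l → ChromaticNumber (Pow (Subdivide G l) (suc (2 * (b * p)))) 3) (thirds (b * z))
        (three (b * p) (suc (3 * (b * z))) (circ⇒3-colorable (b * p) (suc (3 * (b * z))) (3 * (b * (2 * q))) s+d≡
          (circ-mono G q≤p close pq-col)))
    where
    z = p ∸ 2 * q
    z+2q≡p : z + 2 * q ≡ p
    z+2q≡p = m∸n+n≡m 2q≤p
    z<p : z < p
    z<p = subst (z <_) z+2q≡p (m<m+n z (*-mono-≤ {1} {2} (s≤s z≤n) 1≤q))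
    s+d≡ : suc (3 * (b * z)) + 3 * (b * (2 * q)) ≡ suc (3 * (b * p))
    s+d≡ = trans (ring b z (2 * q)) (cong (λ w → suc (3 * (b * w))) z+2q≡p)
      where
      ring : ∀ b z w → suc (3 * (b * z)) + 3 * (b * w) ≡ suc (3 * (b * (z + w)))
      ring = solve-∀
    close : p * (3 * (b * (2 * q))) ≤ 3 * suc (2 * (b * p)) * q
    close = ≤-trans (m≤m+n _ (3 * q)) (≤-reflexive (ring b p q))
      where
      ring : ∀ b p q → p * (3 * (b * (2 * q))) + 3 * q ≡ 3 * suc (2 * (b * p)) * q
      ring = solve-∀

  greatest : ∀ a b → 1 ≤ b → LowerBound G a b → a * q ≤ p * b
  -- The denominator b itself is a large enough scale: that member exceeds p/q by 1/(2bq), whereas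
  -- a/b > p/q would exceed it by at least 1/(bq).
  greatest a b 1≤b lb = ≮⇒≥ λ pb<aq → <⇒≱ (begin-strict
      suc (2 * (p * b))     <⟨ n<1+n _ ⟩
      2 + 2 * (p * b)       ≡⟨ *-suc 2 (p * b) ⟨
      2 * suc (p * b)       ≤⟨ *-monoʳ-≤ 2 pb<aq ⟩
      2 * (a * q)           ∎) bound
    where
    open ≤-Reasoning
    gap : b * p ∸ b * (p ∸ 2 * q) ≡ b * (2 * q)
    gap = trans (sym (*-distribˡ-∸ b p (p ∸ 2 * q))) (cong (b *_) (m∸[m∸n]≡n 2q≤p))
    bound : 2 * (a * q) ≤ suc (2 * (p * b))
    bound = *-cancelˡ-≤ b {{>-nonZero 1≤b}} (begin
      b * (2 * (a * q))                       ≡⟨ ring₁ a b q ⟩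
      a * (b * (2 * q))                       ≡⟨ cong (a *_) gap ⟨
      a * (b * p ∸ b * (p ∸ 2 * q))           ≤⟨ lb (b * p) (b * (p ∸ 2 * q)) (inSet b 1≤b) ⟩
      suc (2 * (b * p)) * b                   ≡⟨ ring₂ b p ⟩
      b * suc (2 * (p * b))                   ∎)
      where
      ring₁ : ∀ a b q → b * (2 * (a * q)) ≡ a * (b * (2 * q))
      ring₁ = solve-∀
      ring₂ : ∀ b p → suc (2 * (b * p)) * b ≡ b * suc (2 * (p * b))
      ring₂ = solve-∀

  small-powers : ∀ r s → suc (2 * r) * (3 * (k ∸ 2)) ≤ k * suc (2 * s) → ChromaticNumber (FracPow G r s) 3
  small-powers r s le with suc (3 * r) ≤? s
  ... | yes m≤s = three r s (long⇒3-colorable r s m≤s)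
  -- Below the threshold k ≤ 3(2r+1)/d, so the k-colouring itself transfers to the circular target.
  ... | no  m≰s = three r s (circ⇒3-colorable r s d s+d≡ (circ-mono G (<⇒≤ 2≤k)
      (subst (k * d ≤_) (sym (*-identityʳ _)) (balanced-≥⇒≤ (threshold k r s d 2≤k s+d≡) le))
      (colorable⇒circ G k-col)))
    where
    d = suc (3 * r) ∸ s
    s+d≡ : s + d ≡ suc (3 * r)
    s+d≡ = m+[n∸m]≡n (<⇒≤ (≰⇒> m≰s))
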